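{- $\mathsf{1XCAP} = \mathsf{P}$, i.e., the class of languages decided in polynomial time by one-cell-decision XCAs equals the class of languages decidable in polynomial time by deterministic Turing machines.
   Context: An XCA (expanding cellular automaton) is a one-dimensional cellular automaton with state set $Q$, neighborhood $\{ -1,0,1\}$, local rule $\delta\colon Q^3\to Q$, quiescent state $q$ and distinguished hidden state $\odot$, where $\delta(\ell)=\odot$ is allowed only if the middle entry of $\ell$ is $\odot$. Cells not in state $q$ (and visible) are active; active cells may not become quiescent. In each global step, every visible cell is updated by the usual CA rule, and between each pair of adjacent visible cells $c(z),c(z+1)$ a hidden cell takes state $\delta(c(z),\odot,c(z+1))$ and is inserted between them; afterwards all cells in state $\odot$ are deleted (contracting the configuration). The input $w$ is written on cells $0,\dots,|w|-1$, surrounded by quiescent cells. A one-cell-decision XCA (1XCA) has an accept state $a$ and a reject state $r$ and accepts (resp. rejects) and halts if and only if the decision cell — the cell that is the leftmost active cell (cell $0$) in the initial configuration — is in state $a$ (resp. $r$). $\mathsf{1XCAP}$ is the class of languages decided by 1XCAs halting on every input within a number of steps polynomial in $|w|$. -}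

module Defs where

open import Level using (0ℓ) renaming (suc to lsuc)
open import Data.Nat using (ℕ; zero; suc; _+_; _*_; _≤_; _<_)
open import Data.Nat.GeneralisedArithmetic using (fold)
open import Data.Integer as ℤ using (ℤ; +_; -[1+_])
open import Data.Fin using (Fin)
import Data.Fin.Properties as Fin
open import Data.List using (List; []; _∷_; map)
open import Data.List.NonEmpty using (List⁺; _∷_; length; toList)
open import Data.Product using (Σ-syntax; ∃-syntax; _×_; _,_)
open import Data.Sum using (_⊎_)
open import Function using (_↔_; Injective)
open import Function.Properties.Inverse using (Inverse⇒Injection)
open import Relation.Binary.Definitions using (DecidableEquality)
open import Relation.Binary.PropositionalEquality using (_≡_; _≢_)
open import Relation.Nullary using (yes; no)
open import Relation.Nullary.Decidable using (via-injection)
open import Relation.Unary using (Pred; _∈_; _∉_)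

-- Languages are subsets of Σ⁺: on the empty input no cell is initially active,
-- so an XCA has no decision cell there.
Language : ℕ → Set₁
Language k = Pred (List⁺ (Fin k)) 0ℓ

-- Coefficients in ascending order of degree.
Polynomial : Set
Polynomial = List ℕ

eval : Polynomial → ℕ → ℕ
eval []      n = 0
eval (a ∷ p) n = a + n * eval p n

-- A run halts the first time it is in one of the two states acc and rej.
module Verdict {S : Set} (acc rej : S) where

  HaltsIn : S → (ℕ → S) → ℕ → Set
  HaltsIn s run t = run t ≡ s × (∀ {u} → u < t → run u ≢ acc × run u ≢ rej)

  DecidesWithin : ∀ {k} → (List⁺ (Fin k) → ℕ → S) → Language k → (ℕ → ℕ) → Set
  DecidesWithin run L T = ∀ w → ∃[ t ] t ≤ T (length w) ×
    ((w ∈ L × HaltsIn acc (run w) t) ⊎ (w ∉ L × HaltsIn rej (run w) t))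

record XCA (k : ℕ) : Set₁ where
  field
    Q      : Set
    size   : ℕ
    finite : Q ↔ Fin size

    -- δ x y z is the new state of a cell in state y between x and z.
    δ   : Q → Q → Q → Q
    q ⊙ : Q
    q≢⊙ : q ≢ ⊙

    -- The all-quiescent configuration is a fixed point, whether or not
    -- quiescent cells are inserted into it.
    quiescent-visible : δ q q q ≡ q
    quiescent-hidden  : δ q ⊙ q ≡ ⊙ ⊎ δ q ⊙ q ≡ q

    δ≡⊙⇒hidden     : ∀ {x y z} → δ x y z ≡ ⊙ → y ≡ ⊙
    δ≡q⇒not-active : ∀ {x y z} → δ x y z ≡ q → y ≡ q ⊎ y ≡ ⊙

    input           : Fin k → Q
    input-injective : Injective _≡_ _≡_ input
    input≢q         : ∀ i → input i ≢ q
    input≢⊙         : ∀ i → input i ≢ ⊙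

    accept reject : Q
    accept≢reject : accept ≢ reject

  _≟_ : DecidableEquality Q
  _≟_ = via-injection (Inverse⇒Injection finite) Fin._≟_

  -- Visible cells only.
  Configuration : Set
  Configuration = ℤ → Q

  data Cell : Set where
    visible : ℤ → Cell
    hidden  : ℤ → Cell  -- hidden z lies between visible z and visible (z + 1)

  expand : Configuration → Cell → Q
  expand c (visible z) = δ (c (ℤ.pred z)) (c z) (c (ℤ.suc z))
  expand c (hidden z)  = δ (c z) ⊙ (c (ℤ.suc z))

  -- Nearest cell to the right, respectively left, remaining after contraction.
  -- A visible cell always remains (δ≡⊙⇒hidden), so at most one cell is skipped.
  next prev : (Cell → Q) → Cell → Cell
  next d (visible z) with d (hidden z) ≟ ⊙
  ... | yes _ = visible (ℤ.suc z)
  ... | no  _ = hidden z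
  next d (hidden z) = visible (ℤ.suc z)
  prev d (visible z) with d (hidden (ℤ.pred z)) ≟ ⊙
  ... | yes _ = visible (ℤ.pred z)
  ... | no  _ = hidden (ℤ.pred z)
  prev d (hidden z) = visible z

  -- The remaining cells are renumbered so that cell 0 keeps its number; the
  -- decision cell is therefore cell 0 at all times.
  remaining : (Cell → Q) → ℤ → Cell
  remaining d (+ n)    = fold (visible (+ 0)) (next d) n
  remaining d -[1+ n ] = fold (visible (+ 0)) (prev d) (suc n)

  contract : (Cell → Q) → Configuration
  contract d z = d (remaining d z)

  step : Configuration → Configuration
  step c = contract (expand c)

  letterAt : List (Fin k) → ℕ → Q
  letterAt []      n       = q
  letterAt (i ∷ w) zero    = input i
  letterAt (i ∷ w) (suc n) = letterAt w n

  initial : List⁺ (Fin k) → Configuration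
  initial w (+ n)    = letterAt (toList w) n
  initial w -[1+ n ] = q

  decisionCell : List⁺ (Fin k) → ℕ → Q
  decisionCell w t = fold (initial w) step t (+ 0)

  open Verdict accept reject using (DecidesWithin)

  DecidesIn : Language k → (ℕ → ℕ) → Set
  DecidesIn = DecidesWithin decisionCell

data Move : Set where
  left right stay : Move

-- The lists run outwards from the head; beyond them the tape is blank.
record Tape (Symbol : Set) : Set where
  constructor tape
  field
    before  : List Symbol
    current : Symbol
    after   : List Symbol

move : ∀ {Symbol} → (blank : Symbol) → Move → Tape Symbol → Tape Symbol
move blank left  (tape []      s r)       = tape [] blank (s ∷ r)
move blank left  (tape (x ∷ l) s r)       = tape l x (s ∷ r)
move blank right (tape l       s [])      = tape (s ∷ l) blank []
move blank right (tape l       s (x ∷ r)) = tape (s ∷ l) x r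
move blank stay  t                        = t

-- Deterministic single-tape machine with a two-way infinite tape.
record TM (k : ℕ) : Set₁ where
  field
    State       : Set
    #states     : ℕ
    finiteState : State ↔ Fin #states

    Symbol       : Set
    #symbols     : ℕ
    finiteSymbol : Symbol ↔ Fin #symbols

    blank           : Symbol
    input           : Fin k → Symbol
    input-injective : Injective _≡_ _≡_ input
    input≢blank     : ∀ i → input i ≢ blank

    start accept reject : State
    accept≢reject       : accept ≢ reject

    δ : State → Symbol → State × Symbol × Move

  step : State × Tape Symbol → State × Tape Symbol
  step (p , tape l s r) =
    let p′ , s′ , m = δ p s in p′ , move blank m (tape l s′ r)

  initial : List⁺ (Fin k) → State × Tape Symbol
  initial (i ∷ w) = start , tape [] (input i) (map input w)

  stateAt : List⁺ (Fin k) → ℕ → State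
  stateAt w t = let p , _ = fold (initial w) step t in p

  open Verdict accept reject using (DecidesWithin)

  DecidesIn : Language k → (ℕ → ℕ) → Set
  DecidesIn = DecidesWithin stateAt

1XCAP : ∀ k → Pred (Language k) (lsuc 0ℓ)
1XCAP k L = Σ[ A ∈ XCA k ] ∃[ p ] XCA.DecidesIn A L (eval p)

P : ∀ k → Pred (Language k) (lsuc 0ℓ)
P k L = Σ[ M ∈ TM k ] ∃[ p ] TM.DecidesIn M L (eval p)

{-# OPTIONS --safe #-}
module Submission where

-- XCA to TM.  A configuration may double in size at every step, but the state of
-- the decision cell at time t + 1 needs only the cells -1, 0, 1 at time t.  The
-- cells on one side of cell 0 at time t + 1 are obtained from those at time t by
-- a finite-state transducer that emits one or two cells per cell read, so the
-- machine keeps on its tape one pair of transducers per time step, the latest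
-- leftmost and the input at the other end.  Fetching the next cell from the
-- latest row pulls at most one cell from each earlier row, hence costs linear
-- time; each step of the XCA requires two such fetches.
--
-- TM to XCA.  No cell is ever inserted: the cells simulate the tape in real time,
-- and once the head halts its verdict spreads until it reaches cell 0, within at
-- most as many steps as the head has made.

open import Data.Bool using (Bool; true; false)
open import Data.Empty using (⊥)
open import Data.Fin using (Fin)
import Data.Fin.Properties as Fin
open import Data.Fin.Properties using (+↔⊎; *↔×; 1↔⊤; 2↔Bool)
import Data.Integer.Properties as ℤ
open import Data.Integer as ℤ using (ℤ; +_; -[1+_])
open import Data.List using (List; []; _∷_; map; length)
open import Data.List.Properties using (length-map)
open import Data.List.NonEmpty as List⁺ using (List⁺; _∷_; toList)
open import Data.Maybe as Maybe using (Maybe; just; nothing; _<∣>_)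
open import Data.Nat using (ℕ; zero; suc; _+_; _*_; _∸_; _≤_; _<_; _≤?_; z≤n; s≤s)
open import Data.Nat.GeneralisedArithmetic using (fold; fold-+)
open import Data.Nat.Properties hiding (_≟_; _≤?_)
open import Data.Nat.Tactic.RingSolver using (solve-∀)
open import Data.Product using (∃-syntax; _×_; _,_; proj₁; proj₂)
open import Data.Product.Function.NonDependent.Propositional using (_×-↔_)
open import Data.Sum using (_⊎_; inj₁; inj₂; [_,_]′)
open import Data.Sum.Function.Propositional using (_⊎-↔_)
open import Data.Unit using (⊤; tt)
open import Function using (_↔_; _∘_; case_of_)
open import Function.Properties.Inverse using (Inverse⇒Injection; ↔-refl; ↔-sym; ↔-trans)
open import Relation.Binary.PropositionalEquality
open import Relation.Nullary using (¬_; Dec; yes; no; contradiction)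
open import Relation.Nullary.Decidable using (via-injection)
open import Relation.Binary.Definitions using (DecidableEquality)
open import Relation.Unary using (_≐_)
import Algebra.Properties.AbelianGroup ℤ.+-0-abelianGroup as ℤ-group
import Algebra.Properties.CommutativeSemigroup ℤ.+-commutativeSemigroup as ℤ-semigroup
open import Defs

-- Finite types.

Finite : Set → Set
Finite A = ∃[ n ] (A ↔ Fin n)

⊤-finite : Finite ⊤
⊤-finite = 1 , ↔-sym 1↔⊤

infixr 1 _⊎-finite_
infixr 2 _×-finite_

_⊎-finite_ : ∀ {A B} → Finite A → Finite B → Finite (A ⊎ B)
(m , f) ⊎-finite (n , g) = m + n , ↔-trans (f ⊎-↔ g) (↔-sym +↔⊎)

_×-finite_ : ∀ {A B} → Finite A → Finite B → Finite (A × B)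
(m , f) ×-finite (n , g) = m * n , ↔-trans (f ×-↔ g) (↔-sym *↔×)

-- Arithmetic of polynomials.

infixl 6 _⊕_
infixl 7 _⊗_

_⊕_ : Polynomial → Polynomial → Polynomial
[]      ⊕ r       = r
(a ∷ p) ⊕ []      = a ∷ p
(a ∷ p) ⊕ (b ∷ r) = a + b ∷ p ⊕ r

_⊗_ : Polynomial → Polynomial → Polynomial
[]      ⊗ r = []
(a ∷ p) ⊗ r = map (a *_) r ⊕ (0 ∷ p ⊗ r)

eval-⊕ : ∀ p r n → eval (p ⊕ r) n ≡ eval p n + eval r n
eval-⊕ []      r       n = refl
eval-⊕ (a ∷ p) []      n = sym (+-identityʳ _)
eval-⊕ (a ∷ p) (b ∷ r) n rewrite eval-⊕ p r n = lemma a b n (eval p n) (eval r n)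
  where
  lemma : ∀ a b n x y → a + b + n * (x + y) ≡ a + n * x + (b + n * y)
  lemma = solve-∀

eval-scale : ∀ a r n → eval (map (a *_) r) n ≡ a * eval r n
eval-scale a []      n = sym (*-zeroʳ a)
eval-scale a (b ∷ r) n rewrite eval-scale a r n = lemma a b n (eval r n)
  where
  lemma : ∀ a b n x → a * b + n * (a * x) ≡ a * (b + n * x)
  lemma = solve-∀

eval-⊗ : ∀ p r n → eval (p ⊗ r) n ≡ eval p n * eval r n
eval-⊗ []      r n = refl
eval-⊗ (a ∷ p) r n
  rewrite eval-⊕ (map (a *_) r) (0 ∷ p ⊗ r) n | eval-scale a r n | eval-⊗ p r n
  = lemma a n (eval p n) (eval r n)
  where
  lemma : ∀ a n x y → a * y + (0 + n * (x * y)) ≡ (a + n * x) * y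
  lemma = solve-∀

-- Neighbours after contraction.

module Contraction {k} (A : XCA k) where
  open XCA A

  next-contracted : ∀ d z → d (hidden z) ≡ ⊙ → next d (visible z) ≡ visible (ℤ.suc z)
  next-contracted d z h with d (hidden z) ≟ ⊙
  ... | yes _ = refl
  ... | no ¬h = contradiction h ¬h

  next-inserted : ∀ d z → d (hidden z) ≢ ⊙ → next d (visible z) ≡ hidden z
  next-inserted d z ¬h with d (hidden z) ≟ ⊙
  ... | yes h = contradiction h ¬h
  ... | no _  = refl

  prev-contracted : ∀ d z → d (hidden (ℤ.pred z)) ≡ ⊙ → prev d (visible z) ≡ visible (ℤ.pred z)
  prev-contracted d z h with d (hidden (ℤ.pred z)) ≟ ⊙
  ... | yes _ = refl
  ... | no ¬h = contradiction h ¬h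

  prev-inserted : ∀ d z → d (hidden (ℤ.pred z)) ≢ ⊙ → prev d (visible z) ≡ hidden (ℤ.pred z)
  prev-inserted d z ¬h with d (hidden (ℤ.pred z)) ≟ ⊙
  ... | yes h = contradiction h ¬h
  ... | no _  = refl

-- Runs of bounded length up to halting.

fold-suc : ∀ {A : Set} (f : A → A) x n → fold (f x) f n ≡ fold x f (suc n)
fold-suc f x n = trans (sym (fold-+ x f n)) (cong (fold x f) (+-comm n 1))

module Reachability {C : Set} (next : C → C) (Halted : C → Set) where

  -- The index only bounds the number of steps from above, since `here` accepts any `n`. The
  -- configurations before the last are not halted; the last may be.
  data _⟶⟨_⟩_ : C → ℕ → C → Set where
    here  : ∀ {c n} → c ⟶⟨ n ⟩ c
    there : ∀ {c n c′} → ¬ Halted c → next c ⟶⟨ n ⟩ c′ → c ⟶⟨ suc n ⟩ c′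

  weaken : ∀ {c m n c′} → m ≤ n → c ⟶⟨ m ⟩ c′ → c ⟶⟨ n ⟩ c′
  weaken m≤n       here        = here
  weaken (s≤s m≤n) (there h p) = there h (weaken m≤n p)

  infixr 5 _▷_

  _▷_ : ∀ {c m c′ n c″} → c ⟶⟨ m ⟩ c′ → c′ ⟶⟨ n ⟩ c″ → c ⟶⟨ m + n ⟩ c″
  _▷_ {m = m} {n = n} here p = weaken (m≤n+m n m) p
  there h p ▷ r = there h (p ▷ r)

  firstVisit : ∀ {c n c′} → c ⟶⟨ n ⟩ c′ →
    ∃[ t ] t ≤ n × fold c next t ≡ c′ × (∀ {u} → u < t → ¬ Halted (fold c next u))
  firstVisit here = 0 , z≤n , refl , λ ()
  firstVisit {c} (there h p) with firstVisit p
  ... | t , t≤n , visit , before =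
    -- `fold` peels off the last step, whereas a path grows at its front; `fold-suc` mediates
    -- between the two.
    suc t , s≤s t≤n , trans (sym (fold-suc next c t)) visit , λ {u} → before′ u
    where
    before′ : ∀ u → u < suc t → ¬ Halted (fold c next u)
    before′ zero    _         = h
    before′ (suc u) (s≤s u<t) = subst (¬_ ∘ Halted) (fold-suc next c u) (before u<t)

-- From XCAs to Turing machines: the transducers for the two sides.

module XCA→TM {k} (A : XCA k) where
  open XCA A
  open Contraction A

  Q-finite : Finite Q
  Q-finite = size , finite

  data Side : Set where
    rightward leftward : Side

  -- Both sides are read outwards from cell 0, so on the left the cell read earlier is the right
  -- neighbour.
  δ[_] : Side → Q → Q → Q → Q
  δ[ rightward ] x y z = δ x y z
  δ[ leftward  ] x y z = δ z y x

  Stream : Set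
  Stream = ℕ → Q

  -- In (a , b , h), a and b are the last two cells read.  All that precedes the
  -- new state of b has been emitted, except possibly the hidden cell h between a
  -- and b; h ≡ ⊙ means that nothing is pending.
  Register : Set
  Register = Q × Q × Q

  opened : Side → Q → Q → Register
  opened d a b = a , b , δ[ d ] a ⊙ b

  -- With nothing pending, the next cell read is the missing outer neighbour of `b`, and the hidden
  -- cell beyond `b` becomes pending. Every unfolding emits a cell, so recursion on the output index
  -- terminates.
  emit : Side → Register → Stream → Stream
  emit d (a , b , h) f n with h ≟ ⊙
  emit d (a , b , h) f zero    | no _  = h
  emit d (a , b , h) f (suc n) | no _  = emit d (a , b , ⊙) f n
  emit d (a , b , h) f zero    | yes _ = δ[ d ] a b (f 0)
  emit d (a , b , h) f (suc n) | yes _ = emit d (opened d b (f 0)) (f ∘ suc) n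

  emit-cong : ∀ d r {f g} → f ≗ g → emit d r f ≗ emit d r g
  emit-cong d (a , b , h) eq n with h ≟ ⊙
  emit-cong d (a , b , h) eq zero    | no _  = refl
  emit-cong d (a , b , h) eq (suc n) | no _  = emit-cong d (a , b , ⊙) eq n
  emit-cong d (a , b , h) eq zero    | yes _ = cong (δ[ d ] a b) (eq 0)
  emit-cong d (a , b , h) {g = g} eq (suc n) | yes _ rewrite eq 0 =
    emit-cong d (opened d b (g 0)) (eq ∘ suc) n

  emit-pending-zero : ∀ d a b {h} f → h ≢ ⊙ → emit d (a , b , h) f 0 ≡ h
  emit-pending-zero d a b {h} f ¬h with h ≟ ⊙
  ... | yes p = contradiction p ¬h
  ... | no _  = refl

  emit-pending-suc : ∀ d a b {h} f n → h ≢ ⊙ →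
    emit d (a , b , h) f (suc n) ≡ emit d (a , b , ⊙) f n
  emit-pending-suc d a b {h} f n ¬h with h ≟ ⊙
  ... | yes p = contradiction p ¬h
  ... | no _  = refl

  emit-clear-zero : ∀ d a b f → emit d (a , b , ⊙) f 0 ≡ δ[ d ] a b (f 0)
  emit-clear-zero d a b f with ⊙ ≟ ⊙
  ... | yes _ = refl
  ... | no ¬p = contradiction refl ¬p

  emit-clear-suc : ∀ d a b f n →
    emit d (a , b , ⊙) f (suc n) ≡ emit d (opened d b (f 0)) (f ∘ suc) n
  emit-clear-suc d a b f n with ⊙ ≟ ⊙
  ... | yes _ = refl
  ... | no ¬p = contradiction refl ¬p

  -- vis and hid enumerate the visible and the hidden cells on one side of cell
  -- 0, outwards; s lists the states of the visible ones before the step.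
  record Walk (d : Side) (e : Cell → Q) (nxt : Cell → Cell)
              (s : Stream) (vis hid : ℕ → Cell) : Set where
    field
      e-visible      : ∀ n → e (vis (suc n)) ≡ δ[ d ] (s n) (s (suc n)) (s (2 + n))
      e-hidden       : ∀ n → e (hid n) ≡ δ[ d ] (s n) ⊙ (s (suc n))
      nxt-hidden     : ∀ n → nxt (hid n) ≡ vis (suc n)
      nxt-contracted : ∀ n → e (hid n) ≡ ⊙ → nxt (vis n) ≡ vis (suc n)
      nxt-inserted   : ∀ n → e (hid n) ≢ ⊙ → nxt (vis n) ≡ hid n

  tail : ∀ {d e nxt s vis hid} → Walk d e nxt s vis hid →
         Walk d e nxt (s ∘ suc) (vis ∘ suc) (hid ∘ suc)
  tail w = record
    { e-visible      = e-visible ∘ suc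
    ; e-hidden       = e-hidden ∘ suc
    ; nxt-hidden     = nxt-hidden ∘ suc
    ; nxt-contracted = nxt-contracted ∘ suc
    ; nxt-inserted   = nxt-inserted ∘ suc
    }
    where open Walk w

  fold-advance : ∀ {x y : Cell} nxt n → nxt x ≡ y → fold x nxt (suc n) ≡ fold y nxt n
  fold-advance {x} nxt n refl = sym (fold-suc nxt x n)

  -- Mutual induction along the walk. If the hidden cell next to `vis 0` is contracted, `nxt` skips
  -- it and nothing is pending; otherwise it is emitted first. Then `emit-walk-clear` emits `vis 1`
  -- and passes to the tail of the walk. `vis 0` itself is never emitted, because its update needs
  -- both sides.
  emit-walk : ∀ {d e nxt s vis hid} → Walk d e nxt s vis hid → ∀ n →
    emit d (opened d (s 0) (s 1)) (s ∘ suc ∘ suc) n ≡ e (fold (vis 0) nxt (suc n))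
  emit-walk-clear : ∀ {d e nxt s vis hid} → Walk d e nxt s vis hid → ∀ n →
    emit d (s 0 , s 1 , ⊙) (s ∘ suc ∘ suc) n ≡ e (fold (vis 1) nxt n)

  emit-walk {d} {e} {nxt} {s} {vis} w n = byCases n (δ[ d ] (s 0) ⊙ (s 1) ≟ ⊙)
    where
    open Walk w
    byCases : ∀ n → Dec (δ[ d ] (s 0) ⊙ (s 1) ≡ ⊙) →
      emit d (opened d (s 0) (s 1)) (s ∘ suc ∘ suc) n ≡ e (fold (vis 0) nxt (suc n))
    byCases n (yes h) =
      trans (cong (λ x → emit d (s 0 , s 1 , x) (s ∘ suc ∘ suc) n) h)
        (trans (emit-walk-clear w n)
          (cong e (sym (fold-advance nxt n (nxt-contracted 0 (trans (e-hidden 0) h))))))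
    byCases zero (no ¬h) =
      trans (emit-pending-zero d _ _ _ ¬h)
        (trans (sym (e-hidden 0))
          (cong e (sym (nxt-inserted 0 (¬h ∘ trans (sym (e-hidden 0)))))))
    byCases (suc n) (no ¬h) =
      trans (emit-pending-suc d _ _ _ n ¬h)
        (trans (emit-walk-clear w n)
          (cong e (sym (trans
            (fold-advance nxt (suc n) (nxt-inserted 0 (¬h ∘ trans (sym (e-hidden 0)))))
            (fold-advance nxt n (nxt-hidden 0))))))

  emit-walk-clear {d} w zero    = trans (emit-clear-zero d _ _ _) (sym (Walk.e-visible w 0))
  emit-walk-clear {d} w (suc n) = trans (emit-clear-suc d _ _ _ n) (emit-walk (tail w) n)

  sideStream : Side → Configuration → Stream
  sideStream rightward c n       = c (+ n)
  sideStream leftward  c zero    = c (+ 0)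
  sideStream leftward  c (suc n) = c -[1+ n ]

  rightWalk : ∀ c → Walk rightward (expand c) (next (expand c))
    (sideStream rightward c) (λ n → visible (+ n)) (λ n → hidden (+ n))
  rightWalk c = record
    { e-visible      = λ _ → refl
    ; e-hidden       = λ _ → refl
    ; nxt-hidden     = λ _ → refl
    ; nxt-contracted = λ n → next-contracted (expand c) (+ n)
    ; nxt-inserted   = λ n → next-inserted (expand c) (+ n)
    }

  leftWalk : ∀ c → Walk leftward (expand c) (prev (expand c))
    (sideStream leftward c)
    (λ { zero → visible (+ 0) ; (suc n) → visible -[1+ n ] }) (λ n → hidden -[1+ n ])
  leftWalk c = record
    { e-visible      = λ { zero → refl ; (suc n) → refl }
    ; e-hidden       = λ { zero → refl ; (suc n) → refl }
    ; nxt-hidden     = λ { zero → refl ; (suc n) → refl }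
    ; nxt-contracted = λ { zero    → prev-contracted (expand c) (+ 0)
                           ; (suc n) → prev-contracted (expand c) -[1+ n ] }
    ; nxt-inserted   = λ { zero    → prev-inserted (expand c) (+ 0)
                           ; (suc n) → prev-inserted (expand c) -[1+ n ] }
    }

  emit-step : ∀ d c n → let s = sideStream d c in
    emit d (opened d (s 0) (s 1)) (s ∘ suc ∘ suc) n ≡ sideStream d (step c) (suc n)
  emit-step rightward c n = emit-walk (rightWalk c) n
  emit-step leftward  c n = emit-walk (leftWalk c) n

  -- The machine.

  -- inj₁ m: the right neighbour of the centre m is being fetched;
  -- inj₂ (m , x): x is that neighbour, and the left one is being fetched.
  Task : Set
  Task = Q ⊎ Q × Q

  side : Task → Side
  side (inj₁ _) = rightward
  side (inj₂ _) = leftward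

  -- Sums and products, so that finiteness comes from `_⊎-finite_` and `_×-finite_`. In `centre m`
  -- the head is on the blank left of all rows and `m` is the state of cell 0; `descend` goes out to
  -- fetch a cell and `ascend` carries it back. `used` is an input cell whose letter has been taken;
  -- `row r l` holds the two registers of one time step.
  State Symbol : Set
  State  = ⊤ ⊎ Q ⊎ Task ⊎ Task × Q
  Symbol = ⊤ ⊎ ⊤ ⊎ Fin k ⊎ Register × Register

  pattern start       = inj₁ tt
  pattern centre m    = inj₂ (inj₁ m)
  pattern descend c   = inj₂ (inj₂ (inj₁ c))
  pattern ascend  c x = inj₂ (inj₂ (inj₂ (c , x)))

  pattern blank    = inj₁ tt
  pattern used     = inj₂ (inj₁ tt)
  pattern letter i = inj₂ (inj₂ (inj₁ i))
  pattern row r l  = inj₂ (inj₂ (inj₂ (r , l)))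

  popRegister : Register → Maybe (Q × Register)
  popRegister (a , b , h) with h ≟ ⊙
  ... | yes _ = nothing
  ... | no _  = just (h , a , b , ⊙)

  pushRegister : Side → Register → Q → Q × Register
  pushRegister d (a , b , h) x = δ[ d ] a b x , opened d b x

  -- What a tape cell can deliver by itself; nothing means that it needs a
  -- cell state from further right.
  pop : Side → Symbol → Maybe (Q × Symbol)
  pop d         blank      = just (q , blank)
  pop rightward used       = nothing
  pop leftward  used       = just (q , used)
  pop rightward (letter i) = just (input i , used)
  pop leftward  (letter i) = just (q , letter i)
  pop rightward (row r l)  = Maybe.map (λ (x , r′) → x , row r′ l) (popRegister r)
  pop leftward  (row r l)  = Maybe.map (λ (x , l′) → x , row r l′) (popRegister l)

  push : Side → Symbol → Q → Q × Symbol
  push rightward (row r l) x = let y , r′ = pushRegister rightward r x in y , row r′ l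
  push leftward  (row r l) x = let y , l′ = pushRegister leftward  l x in y , row r l′
  push _         s         x = x , s

  descended : Task → Symbol → Maybe (Q × Symbol) → State × Symbol × Move
  descended c s nothing         = descend c  , s  , right
  descended c s (just (x , s′)) = ascend c x , s′ , left

  ascended : Task → Q × Symbol → State × Symbol × Move
  ascended c (x , s) = ascend c x , s , left

  δᴹ : State → Symbol → State × Symbol × Move
  δᴹ start (letter i)             = centre (input i) , used , left
  δᴹ start s                      = start , s , stay
  δᴹ (centre m) s                 = descend (inj₁ m) , s , right
  δᴹ (descend c) s                = descended c s (pop (side c) s)
  -- A blank met while ascending is the one left of all rows: on a blank at the far end `pop`
  -- answers, and the ascent starts to its left. After the second fetch the new row overwrites this
  -- blank.
  δᴹ (ascend (inj₁ m) x) blank    = descend (inj₂ (m , x)) , blank , right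
  δᴹ (ascend (inj₂ (m , x)) y) blank =
    centre (δ y m x) , row (opened rightward m x) (opened leftward m y) , left
  δᴹ (ascend c x) s@(inj₂ _)      = ascended c (push (side c) s x)

  State-finite : Finite State
  State-finite = ⊤-finite ⊎-finite Q-finite ⊎-finite Task-finite ⊎-finite
    (Task-finite ×-finite Q-finite)
    where
    Task-finite : Finite Task
    Task-finite = Q-finite ⊎-finite (Q-finite ×-finite Q-finite)

  Symbol-finite : Finite Symbol
  Symbol-finite = ⊤-finite ⊎-finite ⊤-finite ⊎-finite (k , ↔-refl) ⊎-finite
    (Register-finite ×-finite Register-finite)
    where
    Register-finite : Finite Register
    Register-finite = Q-finite ×-finite (Q-finite ×-finite Q-finite)

  machine : TM k
  machine = record
    { State           = State
    ; #states         = proj₁ State-finite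
    ; finiteState     = proj₂ State-finite
    ; Symbol          = Symbol
    ; #symbols        = proj₁ Symbol-finite
    ; finiteSymbol    = proj₂ Symbol-finite
    ; blank           = blank
    ; input           = λ i → letter i
    ; input-injective = λ { refl → refl }
    ; input≢blank     = λ _ ()
    ; start           = start
    ; accept          = centre accept
    ; reject          = centre reject
    ; accept≢reject   = λ { refl → accept≢reject refl }
    ; δ               = δᴹ
    }

  -- Running time of a fetch.

  module M = TM machine

  Halted : State × Tape Symbol → Set
  Halted (p , _) = p ≡ centre accept ⊎ p ≡ centre reject

  open Reachability M.step Halted

  -- The effect of a fetch on the tape right of the head: the recursion is the descent, its return
  -- the ascent. At the end of the list, the blank visited has become part of the tape.
  pull : Side → List Symbol → Q × List Symbol
  pull d []      = q , blank ∷ []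
  pull d (s ∷ R) with pop d s
  ... | just (x , s′) = x , s′ ∷ R
  ... | nothing       = let x , R′ = pull d R; y , s′ = push d s x in y , s′ ∷ R′

  pull-length : ∀ d R → length (proj₂ (pull d R)) ≤ suc (length R)
  pull-length d [] = ≤-refl
  pull-length d (s ∷ R) with pop d s
  ... | just _  = n≤1+n _
  ... | nothing = s≤s (pull-length d R)

  -- `pop` answers on every blank, so the hypothesis excludes the symbol on which `ascend` turns
  -- round.
  ascend-step : ∀ c x s → pop (side c) s ≡ nothing →
    δᴹ (ascend c x) s ≡ ascended c (push (side c) s x)
  ascend-step (inj₁ _) x (inj₂ _) _ = refl
  ascend-step (inj₂ _) x (inj₂ _) _ = refl

  transition : ∀ {p l s r p′ s′ m n c} → ¬ Halted (p , tape l s r) →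
    δᴹ p s ≡ (p′ , s′ , m) →
    (p′ , move blank m (tape l s′ r)) ⟶⟨ n ⟩ c → (p , tape l s r) ⟶⟨ suc n ⟩ c
  transition h refl path = there h path

  -- Each cell of `R` is crossed at most once in either direction, and one more step makes the turn.
  pull-run : ∀ c l y R → let x , R′ = pull (side c) R in
    (descend c , move blank right (tape l y R)) ⟶⟨ 1 + 2 * length R ⟩ (ascend c x , tape l y R′)
  pull-run c l y [] = transition [ (λ ()) , (λ ()) ]′ (descend-blank c) here
    where
    descend-blank : ∀ c → δᴹ (descend c) blank ≡ (ascend c q , blank , left)
    descend-blank (inj₁ _) = refl
    descend-blank (inj₂ _) = refl
  pull-run c l y (s ∷ R) with pop (side c) s in eq
  ... | just (x , s′) =
    transition [ (λ ()) , (λ ()) ]′ (cong (descended c s) eq) here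
  ... | nothing       =
    weaken (≤-reflexive (bound (length R)))
      (transition [ (λ ()) , (λ ()) ]′ (cong (descended c s) eq)
        (pull-run c (y ∷ l) s R ▷
         transition [ (λ ()) , (λ ()) ]′ (ascend-step c (proj₁ (pull (side c) R)) s eq) (here {n = 0})))
    where
    bound : ∀ n → suc (1 + 2 * n + 1) ≡ 1 + 2 * suc n
    bound = solve-∀

  -- Streams delivered by the tape.

  deliver : Side → Symbol → Stream → Stream
  deliver d         blank      f         = λ _ → q
  deliver rightward used       f         = f
  deliver leftward  used       f         = λ _ → q
  deliver rightward (letter i) f zero    = input i
  deliver rightward (letter i) f (suc n) = f n
  deliver leftward  (letter i) f         = λ _ → q
  deliver rightward (row r l)  f         = emit rightward r f
  deliver leftward  (row r l)  f         = emit leftward l f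

  -- The answers to an unlimited sequence of fetches on side `d`, as `pull-future` confirms. It
  -- gives the tape a meaning that does not depend on how far each row has been read.
  future : Side → List Symbol → Stream
  future d []      = λ _ → q
  future d (s ∷ R) = deliver d s (future d R)

  deliver-cong : ∀ d s {f g} → f ≗ g → deliver d s f ≗ deliver d s g
  deliver-cong rightward blank      eq n       = refl
  deliver-cong leftward  blank      eq n       = refl
  deliver-cong rightward used       eq n       = eq n
  deliver-cong leftward  used       eq n       = refl
  deliver-cong rightward (letter i) eq zero    = refl
  deliver-cong rightward (letter i) eq (suc n) = eq n
  deliver-cong leftward  (letter i) eq n       = refl
  deliver-cong rightward (row r l)  eq n       = emit-cong rightward r eq n
  deliver-cong leftward  (row r l)  eq n       = emit-cong leftward l eq n

  _≈_▹_ : Stream → Q → Stream → Set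
  f ≈ x ▹ g = f 0 ≡ x × f ∘ suc ≗ g

  popRegister-just : ∀ d r {x r′} f → popRegister r ≡ just (x , r′) →
    emit d r f ≈ x ▹ emit d r′ f
  popRegister-just d (a , b , h) f eq with h ≟ ⊙
  popRegister-just d (a , b , h) f refl | no _ = refl , λ _ → refl

  popRegister-nothing : ∀ d r f → popRegister r ≡ nothing →
    let x , r′ = pushRegister d r (f 0) in emit d r f ≈ x ▹ emit d r′ (f ∘ suc)
  popRegister-nothing d (a , b , h) f eq with h ≟ ⊙
  ... | yes _ = refl , λ _ → refl

  pop-just : ∀ d s {x s′} f → pop d s ≡ just (x , s′) → deliver d s f ≈ x ▹ deliver d s′ f
  pop-just rightward blank      f refl = refl , λ _ → refl
  pop-just leftward  blank      f refl = refl , λ _ → refl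
  pop-just leftward  used       f refl = refl , λ _ → refl
  pop-just rightward (letter i) f refl = refl , λ _ → refl
  pop-just leftward  (letter i) f refl = refl , λ _ → refl
  pop-just rightward (row r l)  f eq   with popRegister r in eqr
  pop-just rightward (row r l)  f refl | just _ = popRegister-just rightward r f eqr
  pop-just leftward  (row r l)  f eq   with popRegister l in eql
  pop-just leftward  (row r l)  f refl | just _ = popRegister-just leftward l f eql

  pop-nothing : ∀ d s f → pop d s ≡ nothing →
    let x , s′ = push d s (f 0) in deliver d s f ≈ x ▹ deliver d s′ (f ∘ suc)
  pop-nothing rightward used      f eq = refl , λ _ → refl
  pop-nothing rightward (row r l) f eq with popRegister r in eqr
  ... | nothing = popRegister-nothing rightward r f eqr
  pop-nothing leftward  (row r l) f eq with popRegister l in eql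
  ... | nothing = popRegister-nothing leftward l f eql

  opposite : Side → Side
  opposite rightward = leftward
  opposite leftward  = rightward

  -- The two registers of a row are independent, and a letter replaced by `used` still delivers only
  -- `q` leftward. Hence fetching on one side does not disturb the other.
  pop-opposite : ∀ d s {x s′} f → pop d s ≡ just (x , s′) →
    deliver (opposite d) s′ f ≗ deliver (opposite d) s f
  pop-opposite rightward blank      f refl n = refl
  pop-opposite leftward  blank      f refl n = refl
  pop-opposite leftward  used       f refl n = refl
  pop-opposite rightward (letter i) f refl n = refl
  pop-opposite leftward  (letter i) f refl n = refl
  pop-opposite rightward (row r l)  f eq   n with popRegister r
  pop-opposite rightward (row r l)  f refl n | just _ = refl
  pop-opposite leftward  (row r l)  f eq   n with popRegister l
  pop-opposite leftward  (row r l)  f refl n | just _ = refl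

  push-opposite : ∀ d s x f →
    deliver (opposite d) (proj₂ (push d s x)) f ≗ deliver (opposite d) s f
  push-opposite rightward blank      x f n = refl
  push-opposite leftward  blank      x f n = refl
  push-opposite rightward used       x f n = refl
  push-opposite leftward  used       x f n = refl
  push-opposite rightward (letter i) x f n = refl
  push-opposite leftward  (letter i) x f n = refl
  push-opposite rightward (row r l)  x f n = refl
  push-opposite leftward  (row r l)  x f n = refl

  pull-future : ∀ d R → let x , R′ = pull d R in future d R ≈ x ▹ future d R′
  pull-future rightward [] = refl , λ _ → refl
  pull-future leftward  [] = refl , λ _ → refl
  pull-future d (s ∷ R) with pop d s in eq
  ... | just _  = pop-just d s (future d R) eq
  ... | nothing with pull d R | pull-future d R
  -- Matching on `refl` identifies the state pushed with `future d R 0`, the form in which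
  -- `pop-nothing` needs it.
  ... | x , R′  | refl , later =
    let first , rest = pop-nothing d s (future d R) eq in
    first , λ n → trans (rest n) (deliver-cong d (proj₂ (push d s x)) later n)

  pull-opposite : ∀ d R → future (opposite d) (proj₂ (pull d R)) ≗ future (opposite d) R
  pull-opposite rightward [] n = refl
  pull-opposite leftward  [] n = refl
  pull-opposite d (s ∷ R) n with pop d s in eq
  ... | just _  = pop-opposite d s (future (opposite d) R) eq n
  ... | nothing = trans (push-opposite d s (proj₁ (pull d R)) _ n)
                        (deliver-cong (opposite d) s (pull-opposite d R) n)

  -- Simulation of the XCA, one round per step.

  Represents : Configuration → List Symbol → Set
  Represents c R = ∀ d n → future d R n ≡ sideStream d c (suc n)

  -- Each of the two fetches lengthens the tape by at most one blank, and the new row adds one cell.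
  -- The time is that of the two fetches, the second on a tape one cell longer, and three steps on
  -- the blank at the left.
  round : ∀ {c R} → Represents c R → ∀ {m} → m ≡ c (+ 0) → m ≢ accept × m ≢ reject →
    ∃[ R′ ] Represents (step c) R′ × length R′ ≤ 3 + length R ×
      (centre m , tape [] blank R) ⟶⟨ 7 + 4 * length R ⟩
      (centre (step c (+ 0)) , tape [] blank R′)
  round {c} {R} rep {m} refl (≢acc , ≢rej)
    with pull rightward R | pull-future rightward R | pull-opposite rightward R
       | pull-length rightward R | pull-run (inj₁ m) [] blank R
  ... | x , R₁ | x-first , R₁-right | R₁-left | R₁-length | run₁
    with pull leftward R₁ | pull-future leftward R₁ | pull-opposite leftward R₁
       | pull-length leftward R₁ | pull-run (inj₂ (m , x)) [] blank R₁
  ... | y , R₂ | y-first , R₂-left | R₂-right | R₂-length | run₂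
    -- `x` and `y` are the neighbours of cell 0. For `y` the leftward future must have survived the
    -- rightward fetch.
    with refl ← trans (sym x-first) (rep rightward 0)
       | refl ← trans (sym y-first) (trans (R₁-left 0) (rep leftward 0))
    = row (opened rightward m x) (opened leftward m y) ∷ R₂
    , rep′
    , s≤s (≤-trans R₂-length (s≤s R₁-length))
    , weaken (≤-trans (s≤s (+-monoʳ-≤ (1 + 2 * length R)
                        (s≤s (+-monoˡ-≤ 1 (s≤s (*-monoʳ-≤ 2 R₁-length))))))
                      (≤-reflexive (bound (length R))))
        (transition [ (λ { refl → ≢acc refl }) , (λ { refl → ≢rej refl }) ]′ refl
          (run₁ ▷ transition [ (λ ()) , (λ ()) ]′ refl
            (run₂ ▷ transition [ (λ ()) , (λ ()) ]′ refl (here {n = 0}))))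
    where
    rep′ : Represents (step c) (row (opened rightward m x) (opened leftward m y) ∷ R₂)
    rep′ rightward n = trans
      (emit-cong rightward (opened rightward m x)
        (λ i → trans (R₂-right i) (trans (sym (R₁-right i)) (rep rightward (suc i)))) n)
      (emit-step rightward c n)
    rep′ leftward n = trans
      (emit-cong leftward (opened leftward m y)
        (λ i → trans (sym (R₂-left i)) (trans (R₁-left (suc i)) (rep leftward (suc i)))) n)
      (emit-step leftward c n)

    bound : ∀ n → suc (1 + 2 * n + suc (1 + 2 * suc n + 1)) ≡ 7 + 4 * n
    bound = solve-∀

  -- All rounds are charged at the final length bound, which turns the sum of their costs into a
  -- product. The leading 1 is the step that takes the first letter into the control.
  rounds : ∀ w t → (∀ {u} → u < t → decisionCell w u ≢ accept × decisionCell w u ≢ reject) →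
    ∃[ R ] Represents (fold (initial w) step t) R × length R ≤ List⁺.length w + 3 * t ×
      M.initial w ⟶⟨ 1 + t * (7 + 4 * (List⁺.length w + 3 * t)) ⟩
      (centre (decisionCell w t) , tape [] blank R)
  rounds (i ∷ w) zero _ =
    used ∷ map (λ j → letter j) w , rep ,
    ≤-reflexive (cong suc (trans (length-map (λ j → letter j) w) (sym (+-identityʳ _)))) ,
    transition [ (λ ()) , (λ ()) ]′ refl here
    where
    letters : ∀ w n → future rightward (map (λ j → letter j) w) n ≡ letterAt w n
    letters []      n       = refl
    letters (i ∷ w) zero    = refl
    letters (i ∷ w) (suc n) = letters w n

    rep : Represents (initial (i ∷ w)) (used ∷ map (λ j → letter j) w)
    rep rightward n = letters w n
    rep leftward  n = refl
  rounds w (suc t) running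
    with R , rep , R-length , path ← rounds w t (running ∘ m≤n⇒m≤1+n)
    with R′ , rep′ , R′-length , path′ ← round rep refl (running ≤-refl)
    = R′ , rep′
    , ≤-trans R′-length (≤-trans (+-monoʳ-≤ 3 R-length) (≤-reflexive (lengthBound (List⁺.length w) t)))
    , weaken (s≤s timeBound) (path ▷ path′)
    where
    lengthBound : ∀ n t → 3 + (n + 3 * t) ≡ n + 3 * suc t
    lengthBound = solve-∀

    cost : ℕ → ℕ
    cost u = 7 + 4 * (List⁺.length w + 3 * u)

    cost-mono : cost t ≤ cost (suc t)
    cost-mono = +-monoʳ-≤ 7 (*-monoʳ-≤ 4 (+-monoʳ-≤ (List⁺.length w) (*-monoʳ-≤ 3 (n≤1+n t))))

    timeBound : t * cost t + (7 + 4 * length R) ≤ suc t * cost (suc t)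
    timeBound = ≤-trans
      (+-mono-≤ (*-monoʳ-≤ t cost-mono)
                (≤-trans (+-monoʳ-≤ 7 (*-monoʳ-≤ 4 R-length)) cost-mono))
      (≤-reflexive (+-comm (t * cost (suc t)) (cost (suc t))))

  -- The bound of `rounds` with t = p(n), multiplied out to 1 + p(n)(7 + 4n + 12p(n)).
  timeBound : Polynomial → Polynomial
  timeBound p = (1 ∷ []) ⊕ p ⊗ ((7 ∷ 4 ∷ []) ⊕ (12 ∷ []) ⊗ p)

  eval-timeBound : ∀ p n → eval (timeBound p) n ≡ 1 + eval p n * (7 + 4 * (n + 3 * eval p n))
  eval-timeBound p n
    rewrite eval-⊕ (1 ∷ []) (p ⊗ ((7 ∷ 4 ∷ []) ⊕ (12 ∷ []) ⊗ p)) n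
          | eval-⊗ p ((7 ∷ 4 ∷ []) ⊕ (12 ∷ []) ⊗ p) n
          | eval-⊕ (7 ∷ 4 ∷ []) ((12 ∷ []) ⊗ p) n
          | eval-⊗ (12 ∷ []) p n = lemma n (eval p n)
    where
    lemma : ∀ n x → 1 + n * 0 + x * (7 + n * (4 + n * 0) + (12 + n * 0) * x) ≡
      1 + x * (7 + 4 * (n + 3 * x))
    lemma = solve-∀

  eval-timeBound-mono : ∀ p n {t} → t ≤ eval p n →
    1 + t * (7 + 4 * (n + 3 * t)) ≤ eval (timeBound p) n
  eval-timeBound-mono p n t≤ = subst (_ ≤_) (sym (eval-timeBound p n))
    (s≤s (*-mono-≤ t≤ (+-monoʳ-≤ 7 (*-monoʳ-≤ 4 (+-monoʳ-≤ n (*-monoʳ-≤ 3 t≤))))))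

  module V  = Verdict accept reject
  module Vᴹ = Verdict {State} (centre accept) (centre reject)

  -- The path from `rounds` meets no halted configuration before its end, so `firstVisit` yields the
  -- exact halting time.
  halting : ∀ w {t s} → V.HaltsIn s (decisionCell w) t →
    ∃[ t′ ] t′ ≤ 1 + t * (7 + 4 * (List⁺.length w + 3 * t)) ×
      Vᴹ.HaltsIn (centre s) (M.stateAt w) t′
  halting w {t} (refl , running)
    with R , _ , _ , path ← rounds w t running
    with t′ , t′≤ , visit , before ← firstVisit path
    = t′ , t′≤ , cong proj₁ visit , λ u<t′ → before u<t′ ∘ inj₁ , before u<t′ ∘ inj₂

  decides : ∀ {L} p → DecidesIn L (eval p) → M.DecidesIn L (eval (timeBound p))
  decides p D w with D w
  ... | t , t≤ , inj₁ (w∈L , halts) with t′ , t′≤ , halts′ ← halting w halts =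
    t′ , ≤-trans t′≤ (eval-timeBound-mono p _ t≤) , inj₁ (w∈L , halts′)
  ... | t , t≤ , inj₂ (w∉L , halts) with t′ , t′≤ , halts′ ← halting w halts =
    t′ , ≤-trans t′≤ (eval-timeBound-mono p _ t≤) , inj₂ (w∉L , halts′)

-- From Turing machines to XCAs: the automaton.

module TM→XCA {k} (M : TM k) where
  open TM M

  _≟_ : DecidableEquality State
  _≟_ = via-injection (Inverse⇒Injection finiteState) Fin._≟_

  Q : Set
  Q = Bool ⊎ Bool ⊎ Fin k ⊎ Symbol ⊎ State × Symbol

  pattern q         = inj₁ false
  pattern ⊙         = inj₁ true
  pattern verdict b = inj₂ (inj₁ b)
  pattern raw i     = inj₂ (inj₂ (inj₁ i))
  pattern cell s    = inj₂ (inj₂ (inj₂ (inj₁ s)))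
  pattern head p s  = inj₂ (inj₂ (inj₂ (inj₂ (p , s))))

  -- A halting state becomes a verdict on arrival, so no `head` produced here carries one.
  settle : State → Symbol → Q
  settle p s with p ≟ accept | p ≟ reject
  ... | yes _ | _     = verdict true
  ... | no _  | yes _ = verdict false
  ... | no _  | no _  = head p s

  goingRight goingLeft : State × Symbol × Move → Maybe State
  goingRight (p , _ , right) = just p
  goingRight (_ , _ , _)     = nothing
  goingLeft  (p , _ , left)  = just p
  goingLeft  (_ , _ , _)     = nothing

  fromLeft fromRight : Q → Maybe State
  fromLeft  (head p s) = goingRight (δ p s)
  fromLeft  _          = nothing
  fromRight (head p s) = goingLeft (δ p s)
  fromRight _          = nothing

  verdictOf : Q → Maybe Bool
  verdictOf (verdict b) = just b
  verdictOf _           = nothing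

  -- The first letter is recognised by its quiescent left neighbour, which is
  -- why letters are kept apart from tape cells during the first step.
  awaken : Q → Fin k → Q
  awaken q i = settle start (TM.input M i)
  awaken _ i = cell (TM.input M i)

  leave : State × Symbol × Move → Q
  leave (p , s , stay) = settle p s
  leave (_ , s , _)    = cell s

  enter : Q → Symbol → Maybe State → Q
  enter y s nothing  = y
  enter y s (just p) = settle p s

  simulate : Q → Q → Q → Q
  simulate x q           z = enter q blank (fromLeft x <∣> fromRight z)
  simulate x ⊙           z = ⊙
  simulate x (verdict b) z = verdict b
  simulate x (raw i)     z = awaken x i
  simulate x (cell s)    z = enter (cell s) s (fromLeft x <∣> fromRight z)
  simulate x (head p s)  z = leave (δ p s)

  infect : Q → Maybe Bool → Q
  infect y nothing  = y
  infect y (just b) = verdict b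

  δᴬ : Q → Q → Q → Q
  δᴬ x ⊙ z = ⊙
  δᴬ x y z = infect (simulate x y z) (verdictOf x <∣> verdictOf y <∣> verdictOf z)

  -- `q` and `⊙` make up the left summand of `Q`, so this one predicate yields both side conditions
  -- on the local rule.
  Active : Q → Set
  Active (inj₁ _) = ⊥
  Active (inj₂ _) = ⊤

  settle-active : ∀ p s → Active (settle p s)
  settle-active p s with p ≟ accept | p ≟ reject
  ... | yes _ | _     = tt
  ... | no _  | yes _ = tt
  ... | no _  | no _  = tt

  infect-active : ∀ y v → Active y → Active (infect y v)
  infect-active y nothing  a = a
  infect-active y (just b) a = tt

  enter-active : ∀ y s p → Active y → Active (enter y s p)
  enter-active y s nothing  a = a
  enter-active y s (just p) a = settle-active p s

  awaken-active : ∀ x i → Active (awaken x i)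
  awaken-active q        i = settle-active _ _
  awaken-active ⊙        i = tt
  awaken-active (inj₂ _) i = tt

  leave-active : ∀ d → Active (leave d)
  leave-active (p , s , left)  = tt
  leave-active (p , s , right) = tt
  leave-active (p , s , stay)  = settle-active p s

  simulate-active : ∀ x y z → Active y → Active (simulate x y z)
  simulate-active x (verdict b) z _ = tt
  simulate-active x (raw i)     z _ = awaken-active x i
  simulate-active x (cell s)    z _ = enter-active (cell s) s (fromLeft x <∣> fromRight z) tt
  simulate-active x (head p s)  z _ = leave-active (δ p s)

  δ-active : ∀ x y z → Active y → Active (δᴬ x y z)
  δ-active x y@(inj₂ _) z a =
    infect-active (simulate x y z) (verdictOf x <∣> verdictOf y <∣> verdictOf z)
      (simulate-active x y z a)

  δᴬ≡⊙⇒hidden : ∀ x y z → δᴬ x y z ≡ ⊙ → y ≡ ⊙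
  δᴬ≡⊙⇒hidden x ⊙ z _  = refl
  δᴬ≡⊙⇒hidden x q z eq with verdictOf x <∣> verdictOf z | fromLeft x <∣> fromRight z
  -- In the remaining cases the result is `q` or a verdict, visibly different from `⊙`.
  ... | nothing | just p   = contradiction (settle-active p blank) (subst Active eq)
  δᴬ≡⊙⇒hidden x y@(inj₂ _) z eq = contradiction (δ-active x y z tt) (subst Active eq)

  δᴬ≡q⇒not-active : ∀ x y z → δᴬ x y z ≡ q → y ≡ q ⊎ y ≡ ⊙
  δᴬ≡q⇒not-active x q          z _  = inj₁ refl
  δᴬ≡q⇒not-active x ⊙          z _  = inj₂ refl
  δᴬ≡q⇒not-active x y@(inj₂ _) z eq = contradiction (δ-active x y z tt) (subst Active eq)

  Q-finite : Finite Q
  Q-finite = Bool-finite ⊎-finite Bool-finite ⊎-finite (k , ↔-refl) ⊎-finite (#symbols , finiteSymbol)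
    ⊎-finite ((#states , finiteState) ×-finite (#symbols , finiteSymbol))
    where
    Bool-finite : Finite Bool
    Bool-finite = 2 , ↔-sym 2↔Bool

  automaton : XCA k
  automaton = record
    { Q                 = Q
    ; size              = proj₁ Q-finite
    ; finite            = proj₂ Q-finite
    ; δ                 = δᴬ
    ; q                 = q
    ; ⊙                 = ⊙
    ; q≢⊙               = λ ()
    ; quiescent-visible = refl
    ; quiescent-hidden  = inj₁ refl
    ; δ≡⊙⇒hidden        = λ {x y z} → δᴬ≡⊙⇒hidden x y z
    ; δ≡q⇒not-active    = λ {x y z} → δᴬ≡q⇒not-active x y z
    ; input             = λ i → raw i
    ; input-injective   = λ { refl → refl }
    ; input≢q           = λ _ ()
    ; input≢⊙           = λ _ ()
    ; accept            = verdict true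
    ; reject            = verdict false
    ; accept≢reject     = λ ()
    }

  -- Reduction to an ordinary cellular automaton.

  module A = XCA automaton
  open Contraction automaton

  stepped : A.Configuration → A.Configuration
  stepped c z = δᴬ (c (ℤ.pred z)) (c z) (c (ℤ.suc z))

  -- Every hidden cell computes to `⊙` and is deleted at once, so the numbering never changes.
  remaining-visible : ∀ c z → A.remaining (A.expand c) z ≡ A.visible z
  remaining-visible c (+ zero)      = refl
  remaining-visible c (+ (suc n))   =
    trans (cong (A.next (A.expand c)) (remaining-visible c (+ n)))
          (next-contracted (A.expand c) (+ n) refl)
  remaining-visible c -[1+ zero ]   = prev-contracted (A.expand c) (+ 0) refl
  remaining-visible c -[1+ suc n ]  =
    trans (cong (A.prev (A.expand c)) (remaining-visible c -[1+ n ]))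
          (prev-contracted (A.expand c) -[1+ n ] refl)

  step-stepped : ∀ c → A.step c ≗ stepped c
  step-stepped c z = cong (A.expand c) (remaining-visible c z)

  -- Tape contents and one step of the simulation.

  lookup : List Symbol → ℕ → Symbol
  lookup []      n       = blank
  lookup (s ∷ l) zero    = s
  lookup (s ∷ l) (suc n) = lookup l n

  at : Tape Symbol → ℤ → Symbol
  at (tape l s r) (+ zero)  = s
  at (tape l s r) (+ suc n) = lookup r n
  at (tape l s r) -[1+ n ]  = lookup l n

  offset : Move → ℤ
  offset left  = -[1+ 0 ]
  offset right = + 1
  offset stay  = + 0

  -- Coordinates are relative to the head, so a move shifts the whole tape. Where a list is
  -- exhausted, both sides read a blank.
  at-move : ∀ m t i → at (move blank m t) i ≡ at t (offset m ℤ.+ i)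
  at-move left  (tape []      s r) (+ zero)        = refl
  at-move left  (tape []      s r) (+ suc zero)    = refl
  at-move left  (tape []      s r) (+ suc (suc n)) = refl
  at-move left  (tape []      s r) -[1+ n ]        = refl
  at-move left  (tape (x ∷ l) s r) (+ zero)        = refl
  at-move left  (tape (x ∷ l) s r) (+ suc zero)    = refl
  at-move left  (tape (x ∷ l) s r) (+ suc (suc n)) = refl
  at-move left  (tape (x ∷ l) s r) -[1+ n ]        = refl
  at-move right (tape l s [])      (+ zero)        = refl
  at-move right (tape l s [])      (+ suc n)       = refl
  at-move right (tape l s [])      -[1+ zero ]     = refl
  at-move right (tape l s [])      -[1+ suc n ]    = refl
  at-move right (tape l s (x ∷ r)) (+ zero)        = refl
  at-move right (tape l s (x ∷ r)) (+ suc n)       = refl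
  at-move right (tape l s (x ∷ r)) -[1+ zero ]     = refl
  at-move right (tape l s (x ∷ r)) -[1+ suc n ]    = refl
  at-move stay  t                  i               = cong (at t) (sym (ℤ.+-identityˡ i))

  -- A blank has two representations: `q` where no symbol has been written, and `cell blank`
  -- elsewhere, because active cells cannot become quiescent again.
  data Shows : Q → Symbol → Set where
    written   : ∀ {s} → Shows (cell s) s
    untouched : Shows q blank

  Quiet : Q → Set
  Quiet x = verdictOf x ≡ nothing × fromLeft x ≡ nothing × fromRight x ≡ nothing

  shows⇒quiet : ∀ {y s} → Shows y s → Quiet y
  shows⇒quiet written   = refl , refl , refl
  shows⇒quiet untouched = refl , refl , refl

  δ-shows : ∀ {x y z s} → Shows y s → verdictOf x ≡ nothing → verdictOf z ≡ nothing →
    δᴬ x y z ≡ enter y s (fromLeft x <∣> fromRight z)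
  δ-shows written   hx hz rewrite hx | hz = refl
  δ-shows untouched hx hz rewrite hx | hz = refl

  -- A running configuration as seen by its cells, with the outcome of the transition in place of
  -- `δ`, so that the outcome can be abstracted and split by move.
  record Departing (v : ℤ → Q) (t : Tape Symbol) (p : State) (s : Symbol) (m : Move) : Set where
    field
      offHead        : ∀ i → i ≢ + 0 → Shows (v i) (at t i)
      head-verdict   : verdictOf (v (+ 0)) ≡ nothing
      head-fromLeft  : fromLeft (v (+ 0)) ≡ goingRight (p , s , m)
      head-fromRight : fromRight (v (+ 0)) ≡ goingLeft (p , s , m)
      head-stepped   : stepped v (+ 0) ≡ leave (p , s , m)

    offHead-quiet : ∀ i → i ≢ + 0 → Quiet (v i)
    offHead-quiet i i≢0 = shows⇒quiet (offHead i i≢0)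

    undecided : ∀ i → verdictOf (v i) ≡ nothing
    undecided (+ zero)  = head-verdict
    undecided (+ suc n) = proj₁ (offHead-quiet (+ suc n) λ ())
    undecided -[1+ n ]  = proj₁ (offHead-quiet -[1+ n ] λ ())

    stepped-offHead : ∀ i → i ≢ + 0 →
      stepped v i ≡ enter (v i) (at t i) (fromLeft (v (ℤ.pred i)) <∣> fromRight (v (ℤ.suc i)))
    stepped-offHead i i≢0 =
      δ-shows (offHead i i≢0) (undecided (ℤ.pred i)) (undecided (ℤ.suc i))

    stepped-still : ∀ i → i ≢ + 0 →
      fromLeft (v (ℤ.pred i)) ≡ nothing → fromRight (v (ℤ.suc i)) ≡ nothing →
      Shows (stepped v i) (at t i)
    stepped-still i i≢0 hL hR = subst (λ x → Shows x (at t i)) (sym eq) (offHead i i≢0)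
      where
      eq : stepped v i ≡ v i
      eq = trans (stepped-offHead i i≢0) (cong (enter (v i) (at t i)) (cong₂ _<∣>_ hL hR))

  stepped-target : ∀ {v l s r p′ s′} m → Departing v (tape l s r) p′ s′ m →
    stepped v (offset m) ≡ settle p′ (at (tape l s′ r) (offset m))
  stepped-target stay  dep = Departing.head-stepped dep
  stepped-target {v} right dep =
    trans (stepped-offHead (+ 1) λ ()) (cong (λ x → enter _ _ (x <∣> fromRight (v (+ 2)))) head-fromLeft)
    where open Departing dep
  stepped-target left  dep =
    trans (stepped-offHead -[1+ 0 ] λ ())
      -- `_<∣>_` consults the left neighbour first, so cell -2 must be known to send no head.
      (cong₂ (λ x y → enter _ _ (x <∣> y))
        (proj₁ (proj₂ (offHead-quiet -[1+ 1 ] λ ()))) head-fromRight)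
    where open Departing dep

  module _ {v l s r p′ s′ m} (dep : Departing v (tape l s r) p′ s′ m) where
    open Departing dep

    -- Only cell 0 sends a head, and only to `offset m`. Any other cell keeps what it shows, and
    -- cell 0 keeps the symbol just written unless the head stays.
    stepped-other : ∀ i → i ≢ offset m → Shows (stepped v i) (at (tape l s′ r) i)
    stepped-other (+ zero) i≢ = subst (λ x → Shows x s′) (sym (trans head-stepped (leaves m i≢))) written
      where
      leaves : ∀ m → + 0 ≢ offset m → leave (p′ , s′ , m) ≡ cell s′
      leaves left  _ = refl
      leaves right _ = refl
      leaves stay  h = contradiction refl h
    stepped-other (+ suc n) i≢ =
      stepped-still (+ suc n) (λ ()) (before n i≢) (proj₂ (proj₂ (offHead-quiet (+ suc (suc n)) λ ())))
      where
      notRight : ∀ m → + 1 ≢ offset m → goingRight (p′ , s′ , m) ≡ nothing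
      notRight left  _ = refl
      notRight right h = contradiction refl h
      notRight stay  _ = refl

      before : ∀ n → + suc n ≢ offset m → fromLeft (v (+ n)) ≡ nothing
      before zero    i≢ = trans head-fromLeft (notRight m i≢)
      before (suc n) _  = proj₁ (proj₂ (offHead-quiet (+ suc n) λ ()))
    stepped-other -[1+ n ] i≢ =
      stepped-still -[1+ n ] (λ ()) (proj₁ (proj₂ (offHead-quiet -[1+ suc n ] λ ()))) (after n i≢)
      where
      notLeft : ∀ m → -[1+ 0 ] ≢ offset m → goingLeft (p′ , s′ , m) ≡ nothing
      notLeft left  h = contradiction refl h
      notLeft right _ = refl
      notLeft stay  _ = refl

      after : ∀ n → -[1+ n ] ≢ offset m → fromRight (v (ℤ.suc -[1+ n ])) ≡ nothing
      after zero    i≢ = trans head-fromRight (notLeft m i≢)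
      after (suc n) _  = proj₂ (proj₂ (offHead-quiet -[1+ n ] λ ()))

  -- Through `settle`, this also covers the moment at which the machine has just halted and the head
  -- cell is a verdict.
  record Simulates (v : ℤ → Q) (σ : State × Tape Symbol) : Set where
    field
      atHead  : v (+ 0) ≡ settle (proj₁ σ) (at (proj₂ σ) (+ 0))
      offHead : ∀ i → i ≢ + 0 → Shows (v i) (at (proj₂ σ) i)

  settle-running : ∀ {p} s → p ≢ accept × p ≢ reject → settle p s ≡ head p s
  settle-running {p} s (≢acc , ≢rej) with p ≟ accept | p ≟ reject
  ... | yes eq | _      = contradiction eq ≢acc
  ... | no _   | yes eq = contradiction eq ≢rej
  ... | no _   | no _   = refl

  depart : ∀ {v p t} → Simulates v (p , t) → p ≢ accept × p ≢ reject →
    let p′ , s′ , m = δ p (at t (+ 0)) in Departing v t p′ s′ m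
  depart {v} {p} {t} sim running = record
    { offHead        = offHead
    ; head-verdict   = cong verdictOf v0
    ; head-fromLeft  = cong fromLeft v0
    ; head-fromRight = cong fromRight v0
    ; head-stepped   = trans (cong (λ x → δᴬ (v -[1+ 0 ]) x (v (+ 1))) v0) infection
    }
    where
    open Simulates sim
    v0 : v (+ 0) ≡ head p (at t (+ 0))
    v0 = trans atHead (settle-running _ running)

    infection : δᴬ (v -[1+ 0 ]) (head p (at t (+ 0))) (v (+ 1)) ≡ leave (δ p (at t (+ 0)))
    infection rewrite proj₁ (shows⇒quiet (offHead -[1+ 0 ] λ ()))
                    | proj₁ (shows⇒quiet (offHead (+ 1) λ ())) = refl

  simulates-step : ∀ {v p t} → Simulates v (p , t) → p ≢ accept × p ≢ reject →
    let _ , _ , m = δ p (at t (+ 0)) in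
    Simulates (λ i → stepped v (offset m ℤ.+ i)) (step (p , t))
  simulates-step {v} {p} {t@(tape l s r)} sim running with δ p s | depart sim running
  ... | p′ , s′ , m | dep = record
    { atHead  = trans (cong (stepped v) (ℤ.+-identityʳ (offset m)))
                  (trans (stepped-target m dep)
                    (cong (settle p′) (sym (trans (at-move m (tape l s′ r) (+ 0))
                       (cong (at (tape l s′ r)) (ℤ.+-identityʳ (offset m)))))))
    ; offHead = λ i i≢0 → subst (Shows _) (sym (at-move m (tape l s′ r) i))
                  (stepped-other dep (offset m ℤ.+ i)
                    λ eq → i≢0 (ℤ-group.∙-cancelˡ (offset m) _ _ (trans eq (sym (ℤ.+-identityʳ (offset m))))))
    }

  simulates-cong : ∀ {v v′ σ} → v ≗ v′ → Simulates v σ → Simulates v′ σ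
  simulates-cong eq sim = record
    { atHead  = trans (sym (eq (+ 0))) atHead
    ; offHead = λ i i≢0 → subst (λ x → Shows x _) (eq i) (offHead i i≢0)
    }
    where open Simulates sim

  -- Simulation from the initial configuration.

  letterAt-quiet : ∀ w n → Quiet (A.letterAt w n)
  letterAt-quiet []      n       = refl , refl , refl
  letterAt-quiet (i ∷ w) zero    = refl , refl , refl
  letterAt-quiet (i ∷ w) (suc n) = letterAt-quiet w n

  initial-quiet : ∀ w z → Quiet (A.initial w z)
  initial-quiet w (+ n)    = letterAt-quiet (toList w) n
  initial-quiet w -[1+ n ] = refl , refl , refl

  -- The first step of the automaton only turns letters into tape cells and places the head; from
  -- then on it lags one step behind the machine.
  simulates-initial : ∀ w → Simulates (stepped (A.initial w)) (initial w)
  simulates-initial (i ∷ w) = record { atHead = atHead ; offHead = offHead }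
    where
    atHead : stepped (A.initial (i ∷ w)) (+ 0) ≡ settle start (TM.input M i)
    atHead rewrite proj₁ (letterAt-quiet w 0) = refl

    -- Carrying the letter `i` before `w` shows that every letter of `w` has a letter on its left,
    -- so no second head is awakened.
    letters : ∀ i w n z → Quiet z →
      Shows (δᴬ (A.letterAt (i ∷ w) n) (A.letterAt w n) z) (lookup (map (TM.input M) w) n)
    letters i []      zero    z (hv , _ , hR) rewrite hv | hR = untouched
    letters i []      (suc n) z (hv , _ , hR) rewrite hv | hR = untouched
    letters i (j ∷ w) zero    z (hv , _ , hR) rewrite hv      = written
    letters i (j ∷ w) (suc n) z quiet                         = letters j w n z quiet

    offHead : ∀ z → z ≢ + 0 →
      Shows (stepped (A.initial (i ∷ w)) z) (at (tape [] (TM.input M i) (map (TM.input M) w)) z)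
    offHead (+ zero)  z≢0 = contradiction refl z≢0
    offHead (+ suc n) _   = letters i w n _ (letterAt-quiet w (suc n))
    offHead -[1+ n ]  _   with initial-quiet (i ∷ w) (ℤ.suc -[1+ n ])
    ... | hv , _ , hR rewrite hv | hR = untouched

  config : List⁺ (Fin k) → ℕ → A.Configuration
  config w t = fold (A.initial w) A.step t

  view : A.Configuration → ℤ → ℤ → Q
  view c h i = c (i ℤ.+ h)

  step-view : ∀ c h i → stepped (view c h) i ≡ A.step c (i ℤ.+ h)
  step-view c h i = trans
    (cong₂ (λ a b → δᴬ (c a) (c (i ℤ.+ h)) (c b)) (ℤ.+-assoc -[1+ 0 ] i h) (ℤ.+-assoc (+ 1) i h))
    (sym (step-stepped c (i ℤ.+ h)))

  ∣offset∣≤1 : ∀ m → ℤ.∣ offset m ∣ ≤ 1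
  ∣offset∣≤1 left  = ≤-refl
  ∣offset∣≤1 right = ≤-refl
  ∣offset∣≤1 stay  = z≤n

  Running : State → Set
  Running p = p ≢ accept × p ≢ reject

  -- `h` is the position of the head relative to cell 0. It changes by at most one per step, which
  -- later bounds the way of the verdict back.
  simulation : ∀ w t → (∀ {u} → u < t → Running (stateAt w u)) →
    ∃[ h ] ℤ.∣ h ∣ ≤ t × Simulates (view (config w (suc t)) h) (fold (initial w) step t)
  simulation w zero _ = + 0 , z≤n ,
    simulates-cong (λ i → sym (trans (step-stepped (A.initial w) (i ℤ.+ + 0))
                                     (cong (stepped (A.initial w)) (ℤ.+-identityʳ i))))
                   (simulates-initial w)
  simulation w (suc t) running
    with h , h≤t , sim ← simulation w t (running ∘ m≤n⇒m≤1+n)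
    = offset m ℤ.+ h
    , ≤-trans (ℤ.∣i+j∣≤∣i∣+∣j∣ (offset m) h) (+-mono-≤ (∣offset∣≤1 m) h≤t)
    , simulates-cong
        (λ i → trans (step-view c h (offset m ℤ.+ i))
                     (cong (A.step c) (sym (ℤ-semigroup.x∙yz≈yx∙z i (offset m) h))))
        (simulates-step sim (running ≤-refl))
    where
    c : A.Configuration
    c = config w (suc t)
    m : Move
    m = let p , τ = fold (initial w) step t in proj₂ (proj₂ (δ p (at τ (+ 0))))

  -- Spread of the verdict after halting.

  data Calm (b : Bool) : Q → Set where
    decided : Calm b (verdict b)
    plain   : ∀ {y s} → Shows y s → Calm b y

  calm⇒verdict : ∀ {b y} → Calm b y → verdictOf y ≡ nothing ⊎ y ≡ verdict b
  calm⇒verdict decided   = inj₂ refl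
  calm⇒verdict (plain s) = inj₁ (proj₁ (shows⇒quiet s))

  -- `δᴬ` prefers verdicts on the left and in the cell itself; calmness makes these equal to `b` as
  -- well.
  infected-from-right : ∀ {b x y} → Calm b x → Calm b y → δᴬ x y (verdict b) ≡ verdict b
  infected-from-right decided           decided           = refl
  infected-from-right decided           (plain written)   = refl
  infected-from-right decided           (plain untouched) = refl
  infected-from-right (plain written)   decided           = refl
  infected-from-right (plain written)   (plain written)   = refl
  infected-from-right (plain written)   (plain untouched) = refl
  infected-from-right (plain untouched) decided           = refl
  infected-from-right (plain untouched) (plain written)   = refl
  infected-from-right (plain untouched) (plain untouched) = refl

  infected-from-left : ∀ {b y} z → Calm b y → δᴬ (verdict b) y z ≡ verdict b
  infected-from-left z decided           = refl
  infected-from-left z (plain written)   = refl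
  infected-from-left z (plain untouched) = refl

  δ-calm : ∀ {b x y z} → Calm b x → Calm b y → Calm b z → Calm b (δᴬ x y z)
  δ-calm {b} {z = z} decided y _ = subst (Calm b) (sym (infected-from-left z y)) decided
  δ-calm {b} x y decided = subst (Calm b) (sym (infected-from-right x y)) decided
  δ-calm (plain written)   decided           (plain _) = decided
  δ-calm (plain untouched) decided           (plain _) = decided
  δ-calm (plain s) (plain t) (plain u)
    with shows⇒quiet s | shows⇒quiet u
  ... | xv , xL , _ | zv , _ , zR =
    plain (subst (λ a → Shows a _)
      (sym (trans (δ-shows t xv zv) (cong (enter _ _) (cong₂ _<∣>_ xL zR)))) t)

  step-calm : ∀ {b c} → (∀ z → Calm b (c z)) → ∀ z → Calm b (A.step c z)
  step-calm {b} {c} calm z = subst (Calm b) (sym (step-stepped c z))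
    (δ-calm (calm (ℤ.pred z)) (calm z) (calm (ℤ.suc z)))

  steps-calm : ∀ {b c} → (∀ z → Calm b (c z)) → ∀ n z → Calm b (fold c A.step n z)
  steps-calm calm zero    = calm
  steps-calm calm (suc n) = step-calm (steps-calm calm n)

  spread-left : ∀ {b c} → (∀ z → Calm b (c z)) → ∀ z → c (ℤ.suc z) ≡ verdict b → A.step c z ≡ verdict b
  spread-left {c = c} calm z eq = trans (step-stepped c z)
    (trans (cong (δᴬ (c (ℤ.pred z)) (c z)) eq) (infected-from-right (calm (ℤ.pred z)) (calm z)))

  spread-right : ∀ {b c} → (∀ z → Calm b (c z)) → ∀ z → c (ℤ.pred z) ≡ verdict b → A.step c z ≡ verdict b
  spread-right {c = c} calm z eq = trans (step-stepped c z)
    (trans (cong (λ x → δᴬ x (c z) (c (ℤ.suc z))) eq) (infected-from-left _ (calm z)))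

  -- Each step brings the verdict one cell closer to cell 0; the induction restarts from `A.step c`.
  arrives : ∀ {b} z c → (∀ z → Calm b (c z)) → c z ≡ verdict b →
    fold c A.step ℤ.∣ z ∣ (+ 0) ≡ verdict b
  arrives (+ zero)      c calm eq = eq
  arrives (+ suc n)     c calm eq = trans (cong (λ d → d (+ 0)) (sym (fold-suc A.step c n)))
    (arrives (+ n) (A.step c) (step-calm calm) (spread-left calm (+ n) eq))
  arrives -[1+ zero ]   c calm eq = spread-right calm (+ 0) eq
  arrives -[1+ suc n ]  c calm eq = trans (cong (λ d → d (+ 0)) (sym (fold-suc A.step c (suc n))))
    (arrives -[1+ n ] (A.step c) (step-calm calm) (spread-right calm -[1+ n ] eq))

  -- Halting of the automaton and its time bound.

  final : Bool → State
  final true  = accept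
  final false = reject

  settle-final : ∀ b s → settle (final b) s ≡ verdict b
  settle-final true s with accept ≟ accept
  ... | yes _ = refl
  ... | no ¬p = contradiction refl ¬p
  settle-final false s with reject ≟ accept | reject ≟ reject
  ... | yes p | _     = contradiction (sym p) accept≢reject
  ... | no _  | yes _ = refl
  ... | no _  | no ¬p = contradiction refl ¬p

  module V  = Verdict accept reject
  module Vᴬ = Verdict {Q} (verdict true) (verdict false)

  -- `HaltsIn` asks for the earliest verdict, whereas `arrives` only gives some time at which there
  -- is one. As no verdict but `b` occurs, the earliest is the right one.
  first : ∀ {b} {run : ℕ → Q} → (∀ u → verdictOf (run u) ≡ nothing ⊎ run u ≡ verdict b) → ∀ n →
    (∃[ t ] t < n × Vᴬ.HaltsIn (verdict b) run t) ⊎ (∀ {u} → u < n → verdictOf (run u) ≡ nothing)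
  first harmless zero = inj₂ λ ()
  first {run = run} harmless (suc n) with first harmless n
  ... | inj₁ (t , t<n , halts) = inj₁ (t , m≤n⇒m≤1+n t<n , halts)
  ... | inj₂ free with harmless n
  ...   | inj₂ eq = inj₁ (n , ≤-refl , eq , λ u<n →
            (λ hit → case trans (sym (free u<n)) (cong verdictOf hit) of λ ()) ,
            (λ hit → case trans (sym (free u<n)) (cong verdictOf hit) of λ ()))
  ...   | inj₁ eq = inj₂ λ u<1+n → [ free , (λ { refl → eq }) ]′ (m≤n⇒m<n∨m≡n (≤-pred u<1+n))

  halting : ∀ w b {t} → V.HaltsIn (final b) (stateAt w) t →
    ∃[ t′ ] t′ ≤ 1 + 2 * t × Vᴬ.HaltsIn (verdict b) (A.decisionCell w) t′
  halting w b {t} (halt , running)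
    with h , h≤t , sim ← simulation w t running
    = [ (λ (t′ , t′<n , halts) → t′ , ≤-trans (≤-pred t′<n) bound , halts)
      , (λ free → case trans (sym (free ≤-refl)) (cong verdictOf arrival) of λ ())
      ]′ (first harmless (suc n))
    where
    c : A.Configuration
    c = config w (suc t)

    n : ℕ
    -- The verdict arises at time t + 1 in cell `h` and needs at most ∣h∣ steps to reach cell 0.
    n = ℤ.∣ h ∣ + suc t

    bound : n ≤ 1 + 2 * t
    bound = ≤-trans (+-monoˡ-≤ (suc t) h≤t) (≤-reflexive (lemma t))
      where
      lemma : ∀ t → t + suc t ≡ 1 + 2 * t
      lemma = solve-∀

    open Simulates sim

    c-h : view c h (+ 0) ≡ verdict b
    c-h = trans atHead (trans (cong (λ p → settle p (at (proj₂ (fold (initial w) step t)) (+ 0))) halt)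
                       (settle-final b _))

    centred : ∀ z → (z ℤ.- h) ℤ.+ h ≡ z
    centred z = trans (ℤ.+-assoc z (ℤ.- h) h)
      (trans (cong (λ i → z ℤ.+ i) (ℤ.+-inverseˡ h)) (ℤ.+-identityʳ z))

    calm-view : ∀ i → Calm b (view c h i)
    calm-view i with i ℤ.≟ + 0
    ... | yes refl = subst (Calm b) (sym c-h) decided
    ... | no i≢0   = plain (offHead i i≢0)

    calm : ∀ z → Calm b (c z)
    calm z = subst (Calm b ∘ c) (centred z) (calm-view (z ℤ.- h))

    arrival : A.decisionCell w n ≡ verdict b
    arrival = trans (cong (λ d → d (+ 0)) (fold-+ (A.initial w) A.step ℤ.∣ h ∣))
                    (arrives h c calm (trans (cong c (sym (ℤ.+-identityˡ h))) c-h))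

    -- Up to time `t` the simulated machine is still running and no cell holds a verdict; afterwards
    -- the configuration is calm.
    harmless : ∀ u → verdictOf (A.decisionCell w u) ≡ nothing ⊎ A.decisionCell w u ≡ verdict b
    harmless u with u ≤? t
    harmless zero    | yes _   = inj₁ (proj₁ (initial-quiet w (+ 0)))
    harmless (suc u) | yes u<t = inj₁ (early (simulation w u (running ∘ λ v<u → <-trans v<u u<t)))
      where
      early : (∃[ h ] ℤ.∣ h ∣ ≤ u × Simulates (view (config w (suc u)) h) (fold (initial w) step u)) →
        verdictOf (A.decisionCell w (suc u)) ≡ nothing
      early (h , _ , sim) = subst (λ z → verdictOf (config w (suc u) z) ≡ nothing) (ℤ.+-inverseˡ h)
        -- Seen from the head, cell 0 has coordinate -h.
        (Departing.undecided (depart sim (running u<t)) (ℤ.- h))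
    harmless u       | no u≰t  =
      calm⇒verdict (subst (λ d → Calm b (d (+ 0))) eq (steps-calm calm (u ∸ suc t) (+ 0)))
      where
      eq : fold c A.step (u ∸ suc t) ≡ config w u
      eq = trans (sym (fold-+ (A.initial w) A.step (u ∸ suc t)))
                 (cong (config w) (m∸n+n≡m (≰⇒> u≰t)))

  timeBound : Polynomial → Polynomial
  timeBound p = (1 ∷ []) ⊕ (2 ∷ []) ⊗ p

  eval-timeBound : ∀ p n → eval (timeBound p) n ≡ 1 + 2 * eval p n
  eval-timeBound p n
    rewrite eval-⊕ (1 ∷ []) ((2 ∷ []) ⊗ p) n | eval-⊗ (2 ∷ []) p n = lemma n (eval p n)
    where
    lemma : ∀ n x → 1 + n * 0 + (2 + n * 0) * x ≡ 1 + 2 * x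
    lemma = solve-∀

  timeBound-≤ : ∀ p n {t} → t ≤ eval p n → 1 + 2 * t ≤ eval (timeBound p) n
  timeBound-≤ p n t≤ = subst (_ ≤_) (sym (eval-timeBound p n)) (s≤s (*-monoʳ-≤ 2 t≤))

  decides : ∀ {L} p → DecidesIn L (eval p) → A.DecidesIn L (eval (timeBound p))
  decides p D w with D w
  ... | t , t≤ , inj₁ (w∈L , halts) with t′ , t′≤ , halts′ ← halting w true halts =
    t′ , ≤-trans t′≤ (timeBound-≤ p _ t≤) , inj₁ (w∈L , halts′)
  ... | t , t≤ , inj₂ (w∉L , halts) with t′ , t′≤ , halts′ ← halting w false halts =
    t′ , ≤-trans t′≤ (timeBound-≤ p _ t≤) , inj₂ (w∉L , halts′)

theorem7 : (k : ℕ) → 1XCAP k ≐ P k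
theorem7 k =
  (λ (A , p , D) → XCA→TM.machine A , XCA→TM.timeBound A p , XCA→TM.decides A p D) ,
  (λ (M , p , D) → TM→XCA.automaton M , TM→XCA.timeBound M p , TM→XCA.decides M p D)
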